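{- Let $x_1,x_2,\ldots,y_1,y_2,\ldots$ be indeterminates. For every positive integer $n$, the identity $$\sum_{k=1}^{n}(-1)^{k-1}\frac{y_k}{x_k}=\cfrac{a_1}{b_1+\cfrac{a_2}{b_2+\cdots+\cfrac{a_n}{b_n}}}$$ holds in the field of rational functions over $\mathbb{Q}$ in these indeterminates, where $a_1=y_1$, $b_1=x_1$, and $$a_k=\theta y_{k-1}\cdot\theta x_{k-2},\qquad b_k=\theta x_{k-1}-\theta y_{k-1}\qquad(2\le k\le n).$$
   Context: For a sequence $(u_k)_{k\ge 1}$ of indeterminates, set $u_0=1$ (so $x_0=y_0=1$) and define $\theta u_k=\dfrac{u_{k+1}}{u_k}$ for $k\ge 0$. -}

module Defs where

open import Algebra.Apartness.Bundles using (HeytingCommutativeRing; HeytingField)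
open import Algebra.Bundles using (CommutativeRing; Semiring)
open import Algebra.Definitions using (Invertible)
open import Algebra.Structures using (IsCommutativeRing)
open import Data.List.Base using (List; []; _∷_; map; _++_)
open import Data.List.Membership.Propositional using (_∈_)
open import Data.List.Membership.Propositional.Properties using (∈-++⁺ˡ; ∈-++⁺ʳ)
open import Data.List.Relation.Unary.All as All using (All; []; _∷_)
open import Data.List.Relation.Unary.Any using (here; there)
open import Data.Nat.Base using (ℕ; zero; suc; _∸_)
import Data.Nat.Properties as ℕ
open import Data.Product.Base using (Σ-syntax; ∃-syntax; _×_; _,_; proj₁; proj₂)
open import Data.Rational.Base as ℚ using (ℚ; 0ℚ; 1ℚ)
import Data.Rational.Properties as ℚ
open import Data.Sum.Base using (_⊎_; inj₁; inj₂)
open import Data.Unit.Base using (⊤; tt)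
open import Level using (0ℓ; Lift) renaming (_⊔_ to _⊔ˡ_; suc to sucˡ)
open import Relation.Binary.Bundles using (DecSetoid)
open import Relation.Binary.Definitions using (Decidable; DecidableEquality)
open import Relation.Binary.PropositionalEquality as ≡ using (_≡_; _≢_)
import Relation.Binary.Properties.DecSetoid as DecSetoidProperties
open import Relation.Nullary using (yes; no; ¬_; contradiction)
import Relation.Binary.Reasoning.Setoid as SetoidReasoning
import Algebra.Definitions.RawMonoid as RawMonoidDefinitions
import Algebra.Definitions.RawSemiring as RawSemiringDefinitions
import Algebra.Properties.Group as GroupProperties
import Algebra.Properties.Ring as RingProperties
import Algebra.Solver.Ring.NaturalCoefficients.Default as Solver

record DiscreteDomain c ℓ : Set (sucˡ (c ⊔ˡ ℓ)) where
  field
    commutativeRing : CommutativeRing c ℓ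

  open CommutativeRing commutativeRing public

  field
    _≟_       : Decidable _≈_
    1≉0       : 1# ≉ 0#
    *-nonzero : ∀ {x y} → x ≉ 0# → y ≉ 0# → x * y ≉ 0#

module FractionField {c ℓ} (D : DiscreteDomain c ℓ) where
  open DiscreteDomain D
  open RingProperties ring
  open SetoidReasoning setoid
  open Solver commutativeSemiring using (solve; _:=_; _:+_; _:*_; con)

  record Fraction : Set (c ⊔ˡ ℓ) where
    constructor _∕_[_]
    field
      num   : Carrier
      den   : Carrier
      den≉0 : den ≉ 0#

  open Fraction public

  infix 4 _≈ᶠ_

  -- A record, so that the two fractions can be inferred from a proof.
  record _≈ᶠ_ (p q : Fraction) : Set ℓ where
    constructor cross
    field
      uncross : num p * den q ≈ num q * den p

  open _≈ᶠ_ public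

  _≟ᶠ_ : Decidable _≈ᶠ_
  p ≟ᶠ q with (num p * den q) ≟ (num q * den p)
  ... | yes e = yes (cross e)
  ... | no ne = no λ e → ne (uncross e)

  infixl 6 _+ᶠ_
  infixl 7 _*ᶠ_
  infix  8 -ᶠ_

  _+ᶠ_ _*ᶠ_ : Fraction → Fraction → Fraction
  (a ∕ b [ b≉0 ]) +ᶠ (c ∕ d [ d≉0 ]) = (a * d + c * b) ∕ b * d [ *-nonzero b≉0 d≉0 ]
  (a ∕ b [ b≉0 ]) *ᶠ (c ∕ d [ d≉0 ]) = (a * c) ∕ b * d [ *-nonzero b≉0 d≉0 ]

  -ᶠ_ : Fraction → Fraction
  -ᶠ (a ∕ b [ b≉0 ]) = (- a) ∕ b [ b≉0 ]

  ι : Carrier → Fraction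
  ι a = a ∕ 1# [ 1≉0 ]

  0ᶠ 1ᶠ : Fraction
  0ᶠ = ι 0#
  1ᶠ = ι 1#

  *-cancelʳ-nonzero : ∀ {x y z} → z ≉ 0# → x * z ≈ y * z → x ≈ y
  *-cancelʳ-nonzero {x} {y} {z} z≉0 xz≈yz with (x - y) ≟ 0#
  ... | yes x-y≈0 = x∙y⁻¹≈ε⇒x≈y x y x-y≈0
  ... | no  x-y≉0 = contradiction
    (begin
      (x - y) * z        ≈⟨ distribʳ z x (- y) ⟩
      x * z + (- y) * z  ≈⟨ +-cong xz≈yz (sym (-‿distribˡ-* y z)) ⟩
      y * z - y * z      ≈⟨ -‿inverseʳ (y * z) ⟩
      0#                 ∎)
    (*-nonzero x-y≉0 z≉0)

  ≈ᶠ-refl : ∀ {p} → p ≈ᶠ p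
  ≈ᶠ-refl = cross refl

  ≈ᶠ-sym : ∀ {p q} → p ≈ᶠ q → q ≈ᶠ p
  ≈ᶠ-sym (cross e) = cross (sym e)

  ≈ᶠ-trans : ∀ {p q r} → p ≈ᶠ q → q ≈ᶠ r → p ≈ᶠ r
  ≈ᶠ-trans {a ∕ b [ _ ]} {c ∕ d [ d≉0 ]} {e ∕ f [ _ ]} (cross p) (cross q) =
    cross (*-cancelʳ-nonzero d≉0 (begin
      (a * f) * d  ≈⟨ solve 3 (λ x y z → (x :* y) :* z := (x :* z) :* y) refl a f d ⟩
      (a * d) * f  ≈⟨ *-congʳ p ⟩
      (c * b) * f  ≈⟨ solve 3 (λ x y z → (x :* y) :* z := (x :* z) :* y) refl c b f ⟩
      (c * f) * b  ≈⟨ *-congʳ q ⟩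
      (e * d) * b  ≈⟨ solve 3 (λ x y z → (x :* y) :* z := (x :* z) :* y) refl e d b ⟩
      (e * b) * d  ∎))

  +ᶠ-cong : ∀ {p p′ q q′} → p ≈ᶠ p′ → q ≈ᶠ q′ → p +ᶠ q ≈ᶠ p′ +ᶠ q′
  +ᶠ-cong {a ∕ b [ _ ]} {a′ ∕ b′ [ _ ]} {c ∕ d [ _ ]} {c′ ∕ d′ [ _ ]} (cross p) (cross q) = cross (begin
    (a * d + c * b) * (b′ * d′)
      ≈⟨ solve 6 (λ a b c d b′ d′ → (a :* d :+ c :* b) :* (b′ :* d′)
                  := (a :* b′) :* (d :* d′) :+ (c :* d′) :* (b :* b′)) refl a b c d b′ d′ ⟩
    (a * b′) * (d * d′) + (c * d′) * (b * b′)
      ≈⟨ +-cong (*-congʳ p) (*-congʳ q) ⟩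
    (a′ * b) * (d * d′) + (c′ * d) * (b * b′)
      ≈⟨ solve 6 (λ a′ b c′ d b′ d′ → (a′ :* b) :* (d :* d′) :+ (c′ :* d) :* (b :* b′)
                  := (a′ :* d′ :+ c′ :* b′) :* (b :* d)) refl a′ b c′ d b′ d′ ⟩
    (a′ * d′ + c′ * b′) * (b * d) ∎)

  *ᶠ-cong : ∀ {p p′ q q′} → p ≈ᶠ p′ → q ≈ᶠ q′ → p *ᶠ q ≈ᶠ p′ *ᶠ q′
  *ᶠ-cong {a ∕ b [ _ ]} {a′ ∕ b′ [ _ ]} {c ∕ d [ _ ]} {c′ ∕ d′ [ _ ]} (cross p) (cross q) = cross (begin
    (a * c) * (b′ * d′)  ≈⟨ swap a c b′ d′ ⟩
    (a * b′) * (c * d′)  ≈⟨ *-cong p q ⟩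
    (a′ * b) * (c′ * d)  ≈⟨ swap a′ b c′ d ⟩
    (a′ * c′) * (b * d)  ∎)
    where
    swap : ∀ w x y z → (w * x) * (y * z) ≈ (w * y) * (x * z)
    swap = solve 4 (λ w x y z → (w :* x) :* (y :* z) := (w :* y) :* (x :* z)) refl

  -ᶠ-cong : ∀ {p q} → p ≈ᶠ q → -ᶠ p ≈ᶠ -ᶠ q
  -ᶠ-cong {a ∕ b [ _ ]} {c ∕ d [ _ ]} (cross p) = cross (begin
    (- a) * d  ≈⟨ -‿distribˡ-* a d ⟨
    - (a * d)  ≈⟨ -‿cong p ⟩
    - (c * b)  ≈⟨ -‿distribˡ-* c b ⟩
    (- c) * b  ∎)

  +ᶠ-comm : ∀ p q → p +ᶠ q ≈ᶠ q +ᶠ p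
  +ᶠ-comm (a ∕ b [ _ ]) (c ∕ d [ _ ]) = cross
    (solve 4 (λ a b c d → (a :* d :+ c :* b) :* (d :* b) := (c :* b :+ a :* d) :* (b :* d)) refl a b c d)

  +ᶠ-assoc : ∀ p q r → (p +ᶠ q) +ᶠ r ≈ᶠ p +ᶠ (q +ᶠ r)
  +ᶠ-assoc (a ∕ b [ _ ]) (c ∕ d [ _ ]) (e ∕ f [ _ ]) = cross
    (solve 6 (λ a b c d e f → ((a :* d :+ c :* b) :* f :+ e :* (b :* d)) :* (b :* (d :* f))
                := (a :* (d :* f) :+ (c :* f :+ e :* d) :* b) :* ((b :* d) :* f)) refl a b c d e f)

  +ᶠ-identityˡ : ∀ p → 0ᶠ +ᶠ p ≈ᶠ p
  +ᶠ-identityˡ (a ∕ b [ _ ]) = cross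
    (solve 2 (λ a b → (con 0 :* b :+ a :* con 1) :* b := a :* (con 1 :* b)) refl a b)

  -ᶠ-inverseˡ : ∀ p → (-ᶠ p) +ᶠ p ≈ᶠ 0ᶠ
  -ᶠ-inverseˡ (a ∕ b [ _ ]) = cross (begin
    ((- a) * b + a * b) * 1#  ≈⟨ *-identityʳ _ ⟩
    (- a) * b + a * b         ≈⟨ distribʳ b (- a) a ⟨
    ((- a) + a) * b           ≈⟨ *-congʳ (-‿inverseˡ a) ⟩
    0# * b                    ≈⟨ zeroˡ b ⟩
    0#                        ≈⟨ zeroˡ (b * b) ⟨
    0# * (b * b)              ∎)

  *ᶠ-comm : ∀ p q → p *ᶠ q ≈ᶠ q *ᶠ p
  *ᶠ-comm (a ∕ b [ _ ]) (c ∕ d [ _ ]) = cross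
    (solve 4 (λ a b c d → (a :* c) :* (d :* b) := (c :* a) :* (b :* d)) refl a b c d)

  *ᶠ-assoc : ∀ p q r → (p *ᶠ q) *ᶠ r ≈ᶠ p *ᶠ (q *ᶠ r)
  *ᶠ-assoc (a ∕ b [ _ ]) (c ∕ d [ _ ]) (e ∕ f [ _ ]) = cross
    (solve 6 (λ a b c d e f → ((a :* c) :* e) :* (b :* (d :* f))
                := (a :* (c :* e)) :* ((b :* d) :* f)) refl a b c d e f)

  *ᶠ-identityˡ : ∀ p → 1ᶠ *ᶠ p ≈ᶠ p
  *ᶠ-identityˡ (a ∕ b [ _ ]) = cross
    (solve 2 (λ a b → (con 1 :* a) :* b := a :* (con 1 :* b)) refl a b)

  distribˡᶠ : ∀ p q r → p *ᶠ (q +ᶠ r) ≈ᶠ p *ᶠ q +ᶠ p *ᶠ r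
  distribˡᶠ (a ∕ b [ _ ]) (c ∕ d [ _ ]) (e ∕ f [ _ ]) = cross
    (solve 6 (λ a b c d e f → (a :* (c :* f :+ e :* d)) :* ((b :* d) :* (b :* f))
                := ((a :* c) :* (b :* f) :+ (a :* e) :* (b :* d)) :* (b :* (d :* f))) refl a b c d e f)

  isCommutativeRingᶠ : IsCommutativeRing _≈ᶠ_ _+ᶠ_ _*ᶠ_ -ᶠ_ 0ᶠ 1ᶠ
  isCommutativeRingᶠ = record
    { isRing = record
      { +-isAbelianGroup = record
        { isGroup = record
          { isMonoid = record
            { isSemigroup = record
              { isMagma = record
                { isEquivalence = record { refl = ≈ᶠ-refl ; sym = ≈ᶠ-sym ; trans = ≈ᶠ-trans }
                ; ∙-cong = +ᶠ-cong
                }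
              ; assoc = +ᶠ-assoc
              }
            ; identity = +ᶠ-identityˡ , λ p → ≈ᶠ-trans (+ᶠ-comm p 0ᶠ) (+ᶠ-identityˡ p)
            }
          ; inverse = -ᶠ-inverseˡ , λ p → ≈ᶠ-trans (+ᶠ-comm p (-ᶠ p)) (-ᶠ-inverseˡ p)
          ; ⁻¹-cong = -ᶠ-cong
          }
        ; comm = +ᶠ-comm
        }
      ; *-cong = *ᶠ-cong
      ; *-assoc = *ᶠ-assoc
      ; *-identity = *ᶠ-identityˡ , λ p → ≈ᶠ-trans (*ᶠ-comm p 1ᶠ) (*ᶠ-identityˡ p)
      ; distrib = distribˡᶠ , λ p q r → ≈ᶠ-trans (*ᶠ-comm (q +ᶠ r) p)
          (≈ᶠ-trans (distribˡᶠ p q r) (+ᶠ-cong (*ᶠ-comm p q) (*ᶠ-comm p r)))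
      }
    ; *-comm = *ᶠ-comm
    }

  commutativeRingᶠ : CommutativeRing (c ⊔ˡ ℓ) ℓ
  commutativeRingᶠ = record { isCommutativeRing = isCommutativeRingᶠ }

  private module F where
    open CommutativeRing commutativeRingᶠ public
    open RingProperties (CommutativeRing.ring commutativeRingᶠ) public

  decSetoidᶠ : DecSetoid (c ⊔ˡ ℓ) ℓ
  decSetoidᶠ = record
    { isDecEquivalence = record { isEquivalence = F.isEquivalence ; _≟_ = _≟ᶠ_ } }

  num≉0 : ∀ {p} → ¬ p ≈ᶠ 0ᶠ → num p ≉ 0#
  num≉0 {p} p≉0 n≈0 = p≉0 (cross (begin
    num p * 1#  ≈⟨ *-congʳ n≈0 ⟩
    0# * 1#     ≈⟨ zeroˡ 1# ⟩
    0#          ≈⟨ zeroˡ (den p) ⟨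
    0# * den p  ∎))

  ι≉0 : ∀ {a} → a ≉ 0# → ¬ ι a ≈ᶠ 0ᶠ
  ι≉0 a≉0 (cross e) = a≉0 (*-cancelʳ-nonzero 1≉0 e)

  nonzero⇒invertible : ∀ {p} → ¬ p ≈ᶠ 0ᶠ → Invertible _≈ᶠ_ 1ᶠ _*ᶠ_ p
  nonzero⇒invertible {p@(a ∕ b [ b≉0 ])} p≉0 =
    b ∕ a [ num≉0 p≉0 ] , inverseˡ , ≈ᶠ-trans (*ᶠ-comm p (b ∕ a [ num≉0 p≉0 ])) inverseˡ
    where
    inverseˡ : (b ∕ a [ num≉0 p≉0 ]) *ᶠ p ≈ᶠ 1ᶠ
    inverseˡ = cross (solve 2 (λ a b → (b :* a) :* con 1 := con 1 :* (a :* b)) refl a b)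

  heytingField : HeytingField (c ⊔ˡ ℓ) ℓ ℓ
  heytingField = record
    { Carrier = Fraction
    ; _≈_ = _≈ᶠ_
    ; _#_ = λ p q → ¬ p ≈ᶠ q
    ; _+_ = _+ᶠ_
    ; _*_ = _*ᶠ_
    ; -_ = -ᶠ_
    ; 0# = 0ᶠ
    ; 1# = 1ᶠ
    ; isHeytingField = record
      { isHeytingCommutativeRing = record
        { isCommutativeRing = isCommutativeRingᶠ
        ; isApartnessRelation = DecSetoidProperties.≉-isApartnessRelation decSetoidᶠ
        ; #⇒invertible = λ {p} {q} p≉q → nonzero⇒invertible λ e → p≉q (F.x∙y⁻¹≈ε⇒x≈y p q e)
        ; invertible⇒# = λ {p} {q} inv p≈q → ι≉0 1≉0
            (F.trans (F.sym (proj₁ (proj₂ inv)))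
              (F.trans (F.*-congˡ {proj₁ inv} (F.x≈y⇒x∙y⁻¹≈ε {p} {q} p≈q)) (F.zeroʳ (proj₁ inv))))
        }
      ; tight = DecSetoidProperties.≉-tight decSetoidᶠ
      }
    }

module Horner {c ℓ} (R : CommutativeRing c ℓ) where
  open CommutativeRing R
  open RingProperties ring
  open SetoidReasoning setoid
  open Solver commutativeSemiring using (solve; _:=_; _:+_; _:*_; con)

  horner : List Carrier → Carrier → Carrier
  horner []       t = 0#
  horner (a ∷ as) t = a + t * horner as t

  infixl 6 _⊕_
  infixl 7 _⊗_

  _⊕_ _⊗_ : List Carrier → List Carrier → List Carrier
  []       ⊕ bs       = bs
  (a ∷ as) ⊕ []       = a ∷ as
  (a ∷ as) ⊕ (b ∷ bs) = (a + b) ∷ (as ⊕ bs)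
  []       ⊗ bs       = []
  (a ∷ as) ⊗ bs       = map (a *_) bs ⊕ (0# ∷ (as ⊗ bs))

  horner-⊕ : ∀ as bs t → horner (as ⊕ bs) t ≈ horner as t + horner bs t
  horner-⊕ []       bs       t = sym (+-identityˡ _)
  horner-⊕ (a ∷ as) []       t = sym (+-identityʳ _)
  horner-⊕ (a ∷ as) (b ∷ bs) t = begin
    (a + b) + t * horner (as ⊕ bs) t            ≈⟨ +-congˡ (*-congˡ (horner-⊕ as bs t)) ⟩
    (a + b) + t * (horner as t + horner bs t)
      ≈⟨ solve 5 (λ a b t x y → (a :+ b) :+ t :* (x :+ y) := (a :+ t :* x) :+ (b :+ t :* y))
           refl a b t (horner as t) (horner bs t) ⟩
    (a + t * horner as t) + (b + t * horner bs t) ∎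

  horner-scale : ∀ a bs t → horner (map (a *_) bs) t ≈ a * horner bs t
  horner-scale a []       t = sym (zeroʳ a)
  horner-scale a (b ∷ bs) t = begin
    a * b + t * horner (map (a *_) bs) t  ≈⟨ +-congˡ (*-congˡ (horner-scale a bs t)) ⟩
    a * b + t * (a * horner bs t)
      ≈⟨ solve 4 (λ a b t x → a :* b :+ t :* (a :* x) := a :* (b :+ t :* x)) refl a b t (horner bs t) ⟩
    a * (b + t * horner bs t)             ∎

  horner-⊗ : ∀ as bs t → horner (as ⊗ bs) t ≈ horner as t * horner bs t
  horner-⊗ []       bs t = sym (zeroˡ _)
  horner-⊗ (a ∷ as) bs t = begin
    horner (map (a *_) bs ⊕ (0# ∷ (as ⊗ bs))) t                ≈⟨ horner-⊕ (map (a *_) bs) _ t ⟩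
    horner (map (a *_) bs) t + (0# + t * horner (as ⊗ bs) t)
      ≈⟨ +-cong (horner-scale a bs t) (+-congˡ (*-congˡ (horner-⊗ as bs t))) ⟩
    a * horner bs t + (0# + t * (horner as t * horner bs t))
      ≈⟨ solve 4 (λ a t x y → a :* y :+ (con 0 :+ t :* (x :* y)) := (a :+ t :* x) :* y)
           refl a t (horner as t) (horner bs t) ⟩
    (a + t * horner as t) * horner bs t                        ∎

  horner-neg : ∀ as t → horner (map -_ as) t ≈ - horner as t
  horner-neg []       t = sym -0#≈0#
  horner-neg (a ∷ as) t = begin
    - a + t * horner (map -_ as) t  ≈⟨ +-congˡ (*-congˡ (horner-neg as t)) ⟩
    - a + t * (- horner as t)       ≈⟨ +-congˡ (-‿distribʳ-* t (horner as t)) ⟨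
    - a + - (t * horner as t)       ≈⟨ -‿+-comm a _ ⟩
    - (a + t * horner as t)         ∎

  horner-const : ∀ a t → horner (a ∷ []) t ≈ a
  horner-const a t = trans (+-congˡ (zeroʳ t)) (+-identityʳ a)

  horner-linear : ∀ t → horner (0# ∷ 1# ∷ []) t ≈ t
  horner-linear t = solve 1 (λ t → con 0 :+ t :* (con 1 :+ t :* con 0) := t) refl t

  module _ {q} {Q : Carrier → Set q} where

    All-⊕ : (∀ {a b} → Q a → Q b → Q (a + b)) →
            ∀ {as bs} → All Q as → All Q bs → All Q (as ⊕ bs)
    All-⊕ Q+ []       bs       = bs
    All-⊕ Q+ (a ∷ as) []       = a ∷ as
    All-⊕ Q+ (a ∷ as) (b ∷ bs) = Q+ a b ∷ All-⊕ Q+ as bs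

    All-map : ∀ {f : Carrier → Carrier} → (∀ {a} → Q a → Q (f a)) →
              ∀ {as} → All Q as → All Q (map f as)
    All-map Qf []       = []
    All-map Qf (a ∷ as) = Qf a ∷ All-map Qf as

    All-⊗ : Q 0# → (∀ {a b} → Q a → Q b → Q (a + b)) → (∀ {a b} → Q a → Q b → Q (a * b)) →
            ∀ {as bs} → All Q as → All Q bs → All Q (as ⊗ bs)
    All-⊗ Q0 Q+ Q* []       bs = []
    All-⊗ Q0 Q+ Q* (a ∷ as) bs = All-⊕ Q+ (All-map (Q* a) bs) (Q0 ∷ All-⊗ Q0 Q+ Q* as bs)

module UnivariateFunctions where
  open import Data.Rational.Base using (_+_; _*_; -_; _≤_; _<_; ∣_∣; _⊔_)
  open Horner ℚ.+-*-commutativeRing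
  open GroupProperties ℚ.+-0-group using (//-rightDividesʳ)

  IsPolynomial : (ℚ → ℚ) → Set
  IsPolynomial f = ∃[ as ] ∀ t → f t ≡ horner as t

  const-poly : ∀ a → IsPolynomial (λ _ → a)
  const-poly a = a ∷ [] , λ t → ≡.sym (horner-const a t)

  id-poly : IsPolynomial (λ t → t)
  id-poly = 0ℚ ∷ 1ℚ ∷ [] , λ t → ≡.sym (horner-linear t)

  +-poly : ∀ {f g} → IsPolynomial f → IsPolynomial g → IsPolynomial (λ t → f t + g t)
  +-poly (as , f≡) (bs , g≡) =
    as ⊕ bs , λ t → ≡.trans (≡.cong₂ _+_ (f≡ t) (g≡ t)) (≡.sym (horner-⊕ as bs t))

  *-poly : ∀ {f g} → IsPolynomial f → IsPolynomial g → IsPolynomial (λ t → f t * g t)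
  *-poly (as , f≡) (bs , g≡) =
    as ⊗ bs , λ t → ≡.trans (≡.cong₂ _*_ (f≡ t) (g≡ t)) (≡.sym (horner-⊗ as bs t))

  neg-poly : ∀ {f} → IsPolynomial f → IsPolynomial (λ t → - f t)
  neg-poly (as , f≡) = map -_ as , λ t → ≡.trans (≡.cong -_ (f≡ t)) (≡.sym (horner-neg as t))

  EventuallyNonzero : (ℚ → ℚ) → Set
  EventuallyNonzero f = ∃[ T ] ∃[ ε ] 0ℚ < ε × (∀ t → T ≤ t → ε ≤ ∣ f t ∣)

  step-bound : ∀ a {f} → EventuallyNonzero f → EventuallyNonzero (λ t → a + t * f t)
  step-bound a {f} (T , ε , 0<ε , bound) = T′ , 1ℚ , ℚ.positive⁻¹ 1ℚ , bound′
    where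
    instance
      ε>0 = ℚ.positive 0<ε
      ε≥0 = ℚ.nonNegative (ℚ.<⇒≤ 0<ε)
      ε≢0 = ℚ.pos⇒nonZero ε

    s T′ : ℚ
    s  = (1ℚ + ∣ a ∣) * ℚ.1/ ε
    T′ = T ⊔ s

    open ℚ.≤-Reasoning

    bound′ : ∀ t → T′ ≤ t → 1ℚ ≤ ∣ a + t * f t ∣
    bound′ t T′≤t = +-cancelʳ-≤ (∣ a ∣) 1ℚ (∣ a + t * f t ∣) (begin
      1ℚ + ∣ a ∣                     ≡⟨ ℚ.*-identityʳ _ ⟨
      (1ℚ + ∣ a ∣) * 1ℚ              ≡⟨ ≡.cong ((1ℚ + ∣ a ∣) *_) (ℚ.*-inverseˡ ε) ⟨
      (1ℚ + ∣ a ∣) * (ℚ.1/ ε * ε)    ≡⟨ ℚ.*-assoc (1ℚ + ∣ a ∣) (ℚ.1/ ε) ε ⟨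
      s * ε                          ≤⟨ ℚ.*-monoʳ-≤-nonNeg ε (ℚ.≤-trans (ℚ.p≤q⊔p T s) T′≤t) ⟩
      t * ε                          ≤⟨ ℚ.*-monoʳ-≤-nonNeg ε (t≤∣t∣ t) ⟩
      ∣ t ∣ * ε                      ≤⟨ ℚ.*-monoˡ-≤-nonNeg (∣ t ∣) {{ℚ.∣-∣-nonNeg t}}
                                          (bound t (ℚ.≤-trans (ℚ.p≤p⊔q T s) T′≤t)) ⟩
      ∣ t ∣ * ∣ f t ∣                ≡⟨ ℚ.∣p*q∣≡∣p∣*∣q∣ t (f t) ⟨
      ∣ t * f t ∣                    ≡⟨ ≡.cong ∣_∣ (cancel a (t * f t)) ⟨
      ∣ (a + t * f t) + - a ∣        ≤⟨ ℚ.∣p+q∣≤∣p∣+∣q∣ (a + t * f t) (- a) ⟩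
      ∣ a + t * f t ∣ + ∣ - a ∣      ≡⟨ ≡.cong (∣ a + t * f t ∣ +_) (ℚ.∣-p∣≡∣p∣ a) ⟩
      ∣ a + t * f t ∣ + ∣ a ∣        ∎)
      where
      t≤∣t∣ : ∀ t → t ≤ ∣ t ∣
      t≤∣t∣ t with ℚ.≤-total 0ℚ t
      ... | inj₁ 0≤t = ℚ.≤-reflexive (≡.sym (ℚ.0≤p⇒∣p∣≡p 0≤t))
      ... | inj₂ t≤0 = ℚ.≤-trans t≤0 (ℚ.0≤∣p∣ t)

      +-cancelʳ-≤ : ∀ r p q → p + r ≤ q + r → p ≤ q
      +-cancelʳ-≤ r p q p+r≤q+r = ≡.subst₂ _≤_ (//-rightDividesʳ r p) (//-rightDividesʳ r q)
        (ℚ.+-monoˡ-≤ (- r) p+r≤q+r)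

      cancel : ∀ a b → (a + b) + - a ≡ b
      cancel a b = ≡.trans (≡.cong (_+ - a) (ℚ.+-comm a b))
        (≡.trans (ℚ.+-assoc b a (- a))
          (≡.trans (≡.cong (b +_) (ℚ.+-inverseʳ a)) (ℚ.+-identityʳ b)))

  horner-dichotomy : ∀ as → (All (_≡ 0ℚ) as × ∀ t → horner as t ≡ 0ℚ) ⊎ EventuallyNonzero (horner as)
  horner-dichotomy []       = inj₁ ([] , λ _ → ≡.refl)
  horner-dichotomy (a ∷ as) with horner-dichotomy as | a ℚ.≟ 0ℚ
  ... | inj₂ ev         | _       = inj₂ (step-bound a ev)
  ... | inj₁ (zs , as≡0) | yes a≡0 = inj₁ (a≡0 ∷ zs , λ t →
    ≡.trans (≡.cong₂ (λ x y → x + t * y) a≡0 (as≡0 t)) (horner-const 0ℚ t))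
  ... | inj₁ (zs , as≡0) | no a≢0 = inj₂ (0ℚ , ∣ a ∣ , 0<∣a∣ , λ t _ →
    ℚ.≤-reflexive (≡.sym (≡.cong ∣_∣ (≡.trans (≡.cong (λ y → a + t * y) (as≡0 t)) (horner-const a t)))))
    where
    0<∣a∣ : 0ℚ < ∣ a ∣
    0<∣a∣ = ℚ.≰⇒> λ ∣a∣≤0 → a≢0 (ℚ.∣p∣≡0⇒p≡0 a (ℚ.≤-antisym ∣a∣≤0 (ℚ.0≤∣p∣ a)))

  eventually≢0 : ∀ {f} → (ev : EventuallyNonzero f) → ∀ t → proj₁ ev ≤ t → f t ≢ 0ℚ
  eventually≢0 (T , ε , 0<ε , bound) t T≤t ft≡0 =
    ℚ.<-irrefl ≡.refl (ℚ.<-≤-trans 0<ε (≡.subst (λ x → ε ≤ ∣ x ∣) ft≡0 (bound t T≤t)))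

  eventuallyNonzero : ∀ {f} → IsPolynomial f → ∀ t → f t ≢ 0ℚ → EventuallyNonzero f
  eventuallyNonzero (as , f≡) t ft≢0 with horner-dichotomy as
  ... | inj₁ (_ , as≡0) = contradiction (≡.trans (f≡ t) (as≡0 t)) ft≢0
  ... | inj₂ (T , ε , 0<ε , bound) =
    T , ε , 0<ε , λ t T≤t → ≡.subst (λ x → ε ≤ ∣ x ∣) (≡.sym (f≡ t)) (bound t T≤t)

  ℚ-*-nonzero : ∀ {p q} → p ≢ 0ℚ → q ≢ 0ℚ → p * q ≢ 0ℚ
  ℚ-*-nonzero {p} {q} p≢0 q≢0 pq≡0 = p≢0 (begin
    p                  ≡⟨ ℚ.*-identityʳ p ⟨
    p * 1ℚ             ≡⟨ ≡.cong (p *_) (ℚ.*-inverseʳ q) ⟨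
    p * (q * ℚ.1/ q)   ≡⟨ ℚ.*-assoc p q (ℚ.1/ q) ⟨
    (p * q) * ℚ.1/ q   ≡⟨ ≡.cong (_* ℚ.1/ q) pq≡0 ⟩
    0ℚ * ℚ.1/ q        ≡⟨ ℚ.*-zeroˡ (ℚ.1/ q) ⟩
    0ℚ                 ∎)
    where
    open ≡.≡-Reasoning
    instance q-nonZero = ℚ.≢-nonZero q≢0

-- ℚ[V], presented as the free commutative ℚ-algebra on V: polynomial
-- expressions modulo the congruence generated by the ring axioms and the
-- arithmetic of constants.
module Polynomials (V : Set) (_≟ᵛ_ : DecidableEquality V) where

  infixl 6 _:+_
  infixl 7 _:*_
  infix  8 :-_
  infix  4 _≋_

  data Poly : Set where
    con       : ℚ → Poly
    var       : V → Poly
    _:+_ _:*_ : Poly → Poly → Poly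
    :-_       : Poly → Poly

  data _≋_ : Poly → Poly → Set where
    ≋-refl      : ∀ {p} → p ≋ p
    ≋-sym       : ∀ {p q} → p ≋ q → q ≋ p
    ≋-trans     : ∀ {p q r} → p ≋ q → q ≋ r → p ≋ r
    +-cong      : ∀ {p p′ q q′} → p ≋ p′ → q ≋ q′ → p :+ q ≋ p′ :+ q′
    *-cong      : ∀ {p p′ q q′} → p ≋ p′ → q ≋ q′ → p :* q ≋ p′ :* q′
    neg-cong    : ∀ {p q} → p ≋ q → :- p ≋ :- q
    +-assoc     : ∀ p q r → (p :+ q) :+ r ≋ p :+ (q :+ r)
    +-comm      : ∀ p q → p :+ q ≋ q :+ p
    +-identityˡ : ∀ p → con 0ℚ :+ p ≋ p
    +-inverseˡ  : ∀ p → :- p :+ p ≋ con 0ℚ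
    *-assoc     : ∀ p q r → (p :* q) :* r ≋ p :* (q :* r)
    *-comm      : ∀ p q → p :* q ≋ q :* p
    *-identityˡ : ∀ p → con 1ℚ :* p ≋ p
    distribˡ    : ∀ p q r → p :* (q :+ r) ≋ p :* q :+ p :* r
    con-+       : ∀ a b → con a :+ con b ≋ con (a ℚ.+ b)
    con-*       : ∀ a b → con a :* con b ≋ con (a ℚ.* b)

  commutativeRing : CommutativeRing 0ℓ 0ℓ
  commutativeRing = record
    { Carrier = Poly
    ; _≈_ = _≋_
    ; _+_ = _:+_
    ; _*_ = _:*_
    ; -_ = :-_
    ; 0# = con 0ℚ
    ; 1# = con 1ℚ
    ; isCommutativeRing = record
      { isRing = record
        { +-isAbelianGroup = record
          { isGroup = record
            { isMonoid = record
              { isSemigroup = record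
                { isMagma = record
                  { isEquivalence = record { refl = ≋-refl ; sym = ≋-sym ; trans = ≋-trans }
                  ; ∙-cong = +-cong
                  }
                ; assoc = +-assoc
                }
              ; identity = +-identityˡ , λ p → ≋-trans (+-comm p _) (+-identityˡ p)
              }
            ; inverse = +-inverseˡ , λ p → ≋-trans (+-comm p _) (+-inverseˡ p)
            ; ⁻¹-cong = neg-cong
            }
          ; comm = +-comm
          }
        ; *-cong = *-cong
        ; *-assoc = *-assoc
        ; *-identity = *-identityˡ , λ p → ≋-trans (*-comm p _) (*-identityˡ p)
        ; distrib = distribˡ , λ p q r → ≋-trans (*-comm (q :+ r) p)
            (≋-trans (distribˡ p q r) (+-cong (*-comm p q) (*-comm p r)))
        }
      ; *-comm = *-comm
      }
    }

  private
    module ℚᴿ = CommutativeRing ℚ.+-*-commutativeRing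
    module P where
      open CommutativeRing commutativeRing public
      open RingProperties (CommutativeRing.ring commutativeRing) public
    module Hᴾ = Horner commutativeRing
    module Hᴿ = Horner ℚ.+-*-commutativeRing

  eval : (V → ℚ) → Poly → ℚ
  eval u (con a)  = a
  eval u (var v)  = u v
  eval u (p :+ q) = eval u p ℚ.+ eval u q
  eval u (p :* q) = eval u p ℚ.* eval u q
  eval u (:- p)   = ℚ.- eval u p

  eval-cong : ∀ u {p q} → p ≋ q → eval u p ≡ eval u q
  eval-cong u ≋-refl          = ≡.refl
  eval-cong u (≋-sym e)       = ≡.sym (eval-cong u e)
  eval-cong u (≋-trans e f)   = ≡.trans (eval-cong u e) (eval-cong u f)
  eval-cong u (+-cong e f)    = ≡.cong₂ ℚ._+_ (eval-cong u e) (eval-cong u f)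
  eval-cong u (*-cong e f)    = ≡.cong₂ ℚ._*_ (eval-cong u e) (eval-cong u f)
  eval-cong u (neg-cong e)    = ≡.cong ℚ.-_ (eval-cong u e)
  eval-cong u (+-assoc p q r) = ℚ.+-assoc (eval u p) (eval u q) (eval u r)
  eval-cong u (+-comm p q)    = ℚ.+-comm (eval u p) (eval u q)
  eval-cong u (+-identityˡ p) = ℚ.+-identityˡ (eval u p)
  eval-cong u (+-inverseˡ p)  = ℚ.+-inverseˡ (eval u p)
  eval-cong u (*-assoc p q r) = ℚ.*-assoc (eval u p) (eval u q) (eval u r)
  eval-cong u (*-comm p q)    = ℚ.*-comm (eval u p) (eval u q)
  eval-cong u (*-identityˡ p) = ℚ.*-identityˡ (eval u p)
  eval-cong u (distribˡ p q r) = ℚ.*-distribˡ-+ (eval u p) (eval u q) (eval u r)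
  eval-cong u (con-+ a b)     = ≡.refl
  eval-cong u (con-* a b)     = ≡.refl

  eval≢0⇒≉0 : ∀ u {p} → eval u p ≢ 0ℚ → ¬ p ≋ con 0ℚ
  eval≢0⇒≉0 u ne e = ne (eval-cong u e)

  con-neg : ∀ a → :- con a ≋ con (ℚ.- a)
  con-neg a = P.sym (P.+-inverseʳ-unique (con a) (con (ℚ.- a))
    (≋-trans (con-+ a (ℚ.- a)) (P.reflexive (≡.cong con (ℚ.+-inverseʳ a)))))

  -- Over Q p: every variable occurring in p satisfies Q.
  Over : (V → Set) → Poly → Set
  Over Q (con a)  = ⊤
  Over Q (var v)  = Q v
  Over Q (p :+ q) = Over Q p × Over Q q
  Over Q (p :* q) = Over Q p × Over Q q
  Over Q (:- p)   = Over Q p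

  Over-map : ∀ {Q Q′ : V → Set} → (∀ {v} → Q v → Q′ v) → ∀ p → Over Q p → Over Q′ p
  Over-map f (con a)  _         = tt
  Over-map f (var v)  q         = f q
  Over-map f (p :+ q) (op , oq) = Over-map f p op , Over-map f q oq
  Over-map f (p :* q) (op , oq) = Over-map f p op , Over-map f q oq
  Over-map f (:- p)   op        = Over-map f p op

  vars : Poly → List V
  vars (con a)  = []
  vars (var v)  = v ∷ []
  vars (p :+ q) = vars p ++ vars q
  vars (p :* q) = vars p ++ vars q
  vars (:- p)   = vars p

  over-vars : ∀ p → Over (_∈ vars p) p
  over-vars (con a)  = tt
  over-vars (var v)  = here ≡.refl
  over-vars (p :+ q) = Over-map ∈-++⁺ˡ p (over-vars p) , Over-map (∈-++⁺ʳ (vars p)) q (over-vars q)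
  over-vars (p :* q) = Over-map ∈-++⁺ˡ p (over-vars p) , Over-map (∈-++⁺ʳ (vars p)) q (over-vars q)
  over-vars (:- p)   = over-vars p

  eval-agree : ∀ {u w} p → Over (λ v → u v ≡ w v) p → eval u p ≡ eval w p
  eval-agree (con a)  _         = ≡.refl
  eval-agree (var v)  e         = e
  eval-agree (p :+ q) (ep , eq) = ≡.cong₂ ℚ._+_ (eval-agree p ep) (eval-agree q eq)
  eval-agree (p :* q) (ep , eq) = ≡.cong₂ ℚ._*_ (eval-agree p ep) (eval-agree q eq)
  eval-agree (:- p)   ep        = ≡.cong ℚ.-_ (eval-agree p ep)

  closed⇒con : ∀ {Q} → (∀ {v} → ¬ Q v) → ∀ u p → Over Q p → p ≋ con (eval u p)
  closed⇒con ¬Q u (con a)  _         = ≋-refl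
  closed⇒con ¬Q u (var v)  q         = contradiction q ¬Q
  closed⇒con ¬Q u (p :+ q) (op , oq) =
    ≋-trans (+-cong (closed⇒con ¬Q u p op) (closed⇒con ¬Q u q oq)) (con-+ _ _)
  closed⇒con ¬Q u (p :* q) (op , oq) =
    ≋-trans (*-cong (closed⇒con ¬Q u p op) (closed⇒con ¬Q u q oq)) (con-* _ _)
  closed⇒con ¬Q u (:- p)   op        =
    ≋-trans (neg-cong (closed⇒con ¬Q u p op)) (con-neg _)

  -- The coefficients of p as a polynomial in v.
  collect : V → Poly → List Poly
  collect v (con a)  = con a ∷ []
  collect v (var w)  with w ≟ᵛ v
  ... | yes _ = con 0ℚ ∷ con 1ℚ ∷ []
  ... | no  _ = var w ∷ []
  collect v (p :+ q) = collect v p Hᴾ.⊕ collect v q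
  collect v (p :* q) = collect v p Hᴾ.⊗ collect v q
  collect v (:- p)   = map :-_ (collect v p)

  collect-correct : ∀ v p → Hᴾ.horner (collect v p) (var v) ≋ p
  collect-correct v (con a)  = Hᴾ.horner-const (con a) (var v)
  collect-correct v (var w)  with w ≟ᵛ v
  ... | yes ≡.refl = Hᴾ.horner-linear (var v)
  ... | no  _      = Hᴾ.horner-const (var w) (var v)
  collect-correct v (p :+ q) = ≋-trans (Hᴾ.horner-⊕ (collect v p) (collect v q) (var v))
    (+-cong (collect-correct v p) (collect-correct v q))
  collect-correct v (p :* q) = ≋-trans (Hᴾ.horner-⊗ (collect v p) (collect v q) (var v))
    (*-cong (collect-correct v p) (collect-correct v q))
  collect-correct v (:- p)   = ≋-trans (Hᴾ.horner-neg (collect v p) (var v))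
    (neg-cong (collect-correct v p))

  collect-over : ∀ v vs p → Over (_∈ (v ∷ vs)) p → All (Over (λ w → w ∈ vs × w ≢ v)) (collect v p)
  collect-over v vs (con a)  _  = tt ∷ []
  collect-over v vs (var w)  w∈ with w ≟ᵛ v
  ... | yes _ = tt ∷ tt ∷ []
  ... | no w≢v with w∈
  ...   | here w≡v   = contradiction w≡v w≢v
  ...   | there w∈vs = (w∈vs , w≢v) ∷ []
  collect-over v vs (p :+ q) (op , oq) =
    Hᴾ.All-⊕ _,_ (collect-over v vs p op) (collect-over v vs q oq)
  collect-over v vs (p :* q) (op , oq) =
    Hᴾ.All-⊗ tt _,_ _,_ (collect-over v vs p op) (collect-over v vs q oq)
  collect-over v vs (:- p)   op = Hᴾ.All-map (λ o → o) (collect-over v vs p op)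

  horner-zero : ∀ {ps} → All (_≋ con 0ℚ) ps → ∀ t → Hᴾ.horner ps t ≋ con 0ℚ
  horner-zero []       t = ≋-refl
  horner-zero (z ∷ zs) t = ≋-trans
    (+-cong z (≋-trans (P.*-congˡ (horner-zero zs t)) (P.zeroʳ t))) (+-identityˡ _)

  _[_↦_] : (V → ℚ) → V → ℚ → V → ℚ
  (u [ v ↦ a ]) w with w ≟ᵛ v
  ... | yes _ = a
  ... | no  _ = u w

  update-here : ∀ u v a → (u [ v ↦ a ]) v ≡ a
  update-here u v a with v ≟ᵛ v
  ... | yes _  = ≡.refl
  ... | no v≢v = contradiction ≡.refl v≢v

  update-other : ∀ u {v w} a → w ≢ v → (u [ v ↦ a ]) w ≡ u w
  update-other u {v} {w} a w≢v with w ≟ᵛ v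
  ... | yes w≡v = contradiction w≡v w≢v
  ... | no  _   = ≡.refl

  eval-horner : ∀ {Q} u v a ps → (∀ {w} → Q w → w ≢ v) → All (Over Q) ps →
    eval (u [ v ↦ a ]) (Hᴾ.horner ps (var v)) ≡ Hᴿ.horner (map (eval u) ps) a
  eval-horner u v a []       fresh []       = ≡.refl
  eval-horner u v a (p ∷ ps) fresh (o ∷ os) = ≡.cong₂ ℚ._+_
    (eval-agree p (Over-map (λ q → update-other u a (fresh q)) p o))
    (≡.cong₂ ℚ._*_ (update-here u v a) (eval-horner u v a ps fresh os))

  NonvanishingPoint : Poly → Set
  NonvanishingPoint p = ∃[ u ] eval u p ≢ 0ℚ

  zero-or-nonvanishing : ∀ vs p → Over (_∈ vs) p → p ≋ con 0ℚ ⊎ NonvanishingPoint p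
  all-zero-or-nonvanishing : ∀ {Q : V → Set} vs → (∀ {w} → Q w → w ∈ vs) →
    ∀ ps → All (Over Q) ps → All (_≋ con 0ℚ) ps ⊎ ∃[ u ] ¬ All (_≡ 0ℚ) (map (eval u) ps)

  zero-or-nonvanishing [] p o with eval (λ _ → 0ℚ) p ℚ.≟ 0ℚ
  ... | yes e = inj₁ (≋-trans (closed⇒con (λ ()) (λ _ → 0ℚ) p o) (P.reflexive (≡.cong con e)))
  ... | no ne = inj₂ ((λ _ → 0ℚ) , ne)
  zero-or-nonvanishing (v ∷ vs) p o
    with all-zero-or-nonvanishing vs proj₁ (collect v p) (collect-over v vs p o)
  ... | inj₁ zs = inj₁ (≋-trans (≋-sym (collect-correct v p)) (horner-zero zs (var v)))
  ... | inj₂ (u , nz) with UnivariateFunctions.horner-dichotomy (map (eval u) (collect v p))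
  ...   | inj₁ (zs , _) = contradiction zs nz
  ...   | inj₂ ev@(T , _) = inj₂ (u [ v ↦ T ] , λ e →
    UnivariateFunctions.eventually≢0 ev T ℚ.≤-refl
      (≡.trans (≡.sym (eval-horner u v T (collect v p) proj₂ (collect-over v vs p o)))
        (≡.trans (eval-cong (u [ v ↦ T ]) (collect-correct v p)) e)))

  all-zero-or-nonvanishing vs Q⊆vs []       []       = inj₁ []
  all-zero-or-nonvanishing vs Q⊆vs (p ∷ ps) (o ∷ os)
    with zero-or-nonvanishing vs p (Over-map Q⊆vs p o) | all-zero-or-nonvanishing vs Q⊆vs ps os
  ... | inj₂ (u , ne) | _             = inj₂ (u , λ zs → ne (All.head zs))
  ... | inj₁ _        | inj₂ (u , nz) = inj₂ (u , λ zs → nz (All.tail zs))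
  ... | inj₁ z        | inj₁ zs       = inj₁ (z ∷ zs)

  nonvanishingPoint : ∀ {p} → ¬ p ≋ con 0ℚ → NonvanishingPoint p
  nonvanishingPoint {p} p≉0 with zero-or-nonvanishing (vars p) p (over-vars p)
  ... | inj₁ p≈0 = contradiction p≈0 p≉0
  ... | inj₂ pt  = pt

  _≟_ : Decidable _≋_
  p ≟ q with zero-or-nonvanishing (vars d) d (over-vars d) where d = p :+ :- q
  ... | inj₁ d≈0      = yes (P.x∙y⁻¹≈ε⇒x≈y p q d≈0)
  ... | inj₂ (u , ne) = no λ p≈q → ne (eval-cong u (P.x≈y⇒x∙y⁻¹≈ε p≈q))

  line : (V → ℚ) → (V → ℚ) → ℚ → V → ℚ
  line u w t v = u v ℚ.+ t ℚ.* (w v ℚ.- u v)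

  eval-line : ∀ u w p → UnivariateFunctions.IsPolynomial (λ t → eval (line u w t) p)
  eval-line u w (con a)  = UnivariateFunctions.const-poly a
  eval-line u w (var v)  = UnivariateFunctions.+-poly (UnivariateFunctions.const-poly (u v))
    (UnivariateFunctions.*-poly UnivariateFunctions.id-poly
      (UnivariateFunctions.const-poly (w v ℚ.- u v)))
  eval-line u w (p :+ q) = UnivariateFunctions.+-poly (eval-line u w p) (eval-line u w q)
  eval-line u w (p :* q) = UnivariateFunctions.*-poly (eval-line u w p) (eval-line u w q)
  eval-line u w (:- p)   = UnivariateFunctions.neg-poly (eval-line u w p)

  line-0 : ∀ u w p → eval (line u w 0ℚ) p ≡ eval u p
  line-0 u w p = eval-agree p (Over-map (λ {v} _ →
    ≡.trans (≡.cong (u v ℚ.+_) (ℚ.*-zeroˡ (w v ℚ.- u v))) (ℚ.+-identityʳ (u v))) p (over-vars p))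

  line-1 : ∀ u w p → eval (line u w 1ℚ) p ≡ eval w p
  line-1 u w p = eval-agree p (Over-map (λ {v} _ → begin
    u v ℚ.+ 1ℚ ℚ.* (w v ℚ.- u v)      ≡⟨ ≡.cong (u v ℚ.+_) (ℚ.*-identityˡ _) ⟩
    u v ℚ.+ (w v ℚ.- u v)             ≡⟨ ≡.cong (u v ℚ.+_) (ℚ.+-comm (w v) (ℚ.- u v)) ⟩
    u v ℚ.+ (ℚ.- u v ℚ.+ w v)         ≡⟨ ℚ.+-assoc (u v) (ℚ.- u v) (w v) ⟨
    (u v ℚ.- u v) ℚ.+ w v             ≡⟨ ≡.cong (ℚ._+ w v) (ℚ.+-inverseʳ (u v)) ⟩
    0ℚ ℚ.+ w v                        ≡⟨ ℚ.+-identityˡ (w v) ⟩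
    w v                               ∎) p (over-vars p))
    where open ≡.≡-Reasoning

  *-nonzero : ∀ {p q} → ¬ p ≋ con 0ℚ → ¬ q ≋ con 0ℚ → ¬ p :* q ≋ con 0ℚ
  *-nonzero {p} {q} p≉0 q≉0
    with nonvanishingPoint p≉0 | nonvanishingPoint q≉0
  ... | u , pu≢0 | w , qw≢0 = eval≢0⇒≉0 (line u w t)
    (ℚ-*-nonzero
      (eventually≢0 evp t (ℚ.p≤p⊔q (proj₁ evp) (proj₁ evq)))
      (eventually≢0 evq t (ℚ.p≤q⊔p (proj₁ evp) (proj₁ evq))))
    where
    open UnivariateFunctions
    evp : EventuallyNonzero (λ t → eval (line u w t) p)
    evp = eventuallyNonzero (eval-line u w p) 0ℚ (λ e → pu≢0 (≡.trans (≡.sym (line-0 u w p)) e))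
    evq : EventuallyNonzero (λ t → eval (line u w t) q)
    evq = eventuallyNonzero (eval-line u w q) 1ℚ (λ e → qw≢0 (≡.trans (≡.sym (line-1 u w q)) e))
    t : ℚ
    t = proj₁ evp ℚ.⊔ proj₁ evq

  var≉0 : ∀ v → ¬ var v ≋ con 0ℚ
  var≉0 v = eval≢0⇒≉0 (λ _ → 1ℚ) λ ()

  discreteDomain : DiscreteDomain 0ℓ 0ℓ
  discreteDomain = record
    { commutativeRing = commutativeRing
    ; _≟_ = _≟_
    ; 1≉0 = eval≢0⇒≉0 (λ _ → 0ℚ) λ ()
    ; *-nonzero = *-nonzero
    }

module ContinuedFractions {c ℓ₁ ℓ₂} (K : HeytingField c ℓ₁ ℓ₂) where
  open HeytingField K

  infixl 7 _/_[_]

  -- The library inverts differences of apart elements, so the inverse used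
  -- here is that of y - 0#.
  _/_[_] : (x y : Carrier) → y # 0# → Carrier
  x / y [ y#0 ] = x * proj₁ (#⇒invertible y#0)

  module _ (a b : ℕ → Carrier) where

    -- For m ≥ 1, value k m is
    --   a k / (b k + a (k+1) / (b (k+1) + ⋯ + a (k+m-1) / b (k+m-1))),
    -- and Defined k m holds the proofs that the divisors in it are nonzero.
    -- The empty fraction m = 0 is 0# by convention.
    mutual
      Defined : (k m : ℕ) → Set ℓ₂
      Defined k 0             = Lift ℓ₂ ⊤
      Defined k 1             = b k # 0#
      Defined k (suc (suc m)) =
        Σ[ d ∈ Defined (suc k) (suc m) ] (b k + value (suc k) (suc m) d) # 0#

      value : (k m : ℕ) → Defined k m → Carrier
      value k 0             _        = 0#
      value k 1             bk#0     = a k / b k [ bk#0 ]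
      value k (suc (suc m)) (d , e)  = a k / (b k + value (suc k) (suc m) d) [ e ]

data Indeterminate : Set where
  -- X i and Y i stand for x_{i+1} and y_{i+1}.
  X Y : ℕ → Indeterminate

_≟ⁱ_ : DecidableEquality Indeterminate
X i ≟ⁱ X j with i ℕ.≟ j
... | yes ≡.refl = yes ≡.refl
... | no i≢j     = no λ { ≡.refl → i≢j ≡.refl }
X i ≟ⁱ Y j = no λ ()
Y i ≟ⁱ X j = no λ ()
Y i ≟ⁱ Y j with i ℕ.≟ j
... | yes ≡.refl = yes ≡.refl
... | no i≢j     = no λ { ≡.refl → i≢j ≡.refl }

open Polynomials Indeterminate _≟ⁱ_ using (discreteDomain; var; var≉0)
open FractionField discreteDomain using (ι; ι≉0; heytingField)

ℚ⟨x,y⟩ : HeytingField 0ℓ 0ℓ 0ℓ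
ℚ⟨x,y⟩ = heytingField


open HeytingField ℚ⟨x,y⟩ using (Carrier; _+_; _-_; _#_; 0#; heytingCommutativeRing)
open HeytingField ℚ⟨x,y⟩ using (_≈_; _*_; -_; 1#) public
open HeytingCommutativeRing heytingCommutativeRing using (commutativeRing)
open CommutativeRing commutativeRing using (semiring; +-rawMonoid)
open RawMonoidDefinitions +-rawMonoid using (sum) public
open RawSemiringDefinitions (Semiring.rawSemiring semiring) using (_^_) public
open ContinuedFractions ℚ⟨x,y⟩ public

x y : ℕ → Carrier
x zero    = 1#
x (suc i) = ι (var (X i))
y zero    = 1#
y (suc i) = ι (var (Y i))

1#0 : 1# # 0#
1#0 = ι≉0 (DiscreteDomain.1≉0 discreteDomain)

x#0 : ∀ k → x k # 0#
x#0 zero    = 1#0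
x#0 (suc i) = ι≉0 (var≉0 (X i))

y#0 : ∀ k → y k # 0#
y#0 zero    = 1#0
y#0 (suc i) = ι≉0 (var≉0 (Y i))

θ : (u : ℕ → Carrier) → (∀ k → u k # 0#) → ℕ → Carrier
θ u u#0 k = u (suc k) / u k [ u#0 k ]

θx θy : ℕ → Carrier
θx = θ x x#0
θy = θ y y#0

-- The sequences start at index 1; the value at 0 is never used.
a b : ℕ → Carrier
a 0               = 0#
a 1               = y 1
a k@(suc (suc _)) = θy (k ∸ 1) * θx (k ∸ 2)
b 0               = 0#
b 1               = x 1
b k@(suc (suc _)) = θx (k ∸ 1) - θy (k ∸ 1)

{-# OPTIONS --safe #-}

-- Write q k = y k / x k and let A k n be the alternating sum
-- q k − q (k+1) + ⋯ of n terms, so that A k (1+n) + A (k+1) n = q k.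
-- By induction on m, the tail of the continued fraction that starts at
-- index k+2 and has m levels equals θx k · A (k+2) m / A (k+1) (m+1), and the
-- divisor at its top equals θy (k+1) · A (k+1) (m+1) / A (k+2) m.  Beyond the
-- recursion of A, the induction only needs θx k · q (k+1) = θy k · q k.  No
-- alternating sum A k (1+n) vanishes, because it takes the value 1 at the
-- point where every x is 1, y k is 1 and the other y's are 0.
module Submission where

open import Algebra.Apartness.Bundles using (HeytingCommutativeRing; HeytingField)
import Algebra.Apartness.Properties.HeytingCommutativeRing as HeytingProperties
open import Algebra.Bundles using (CommutativeRing; Semiring)
import Algebra.Definitions.RawMonoid as RawMonoidDefinitions
import Algebra.Definitions.RawSemiring as RawSemiringDefinitions
import Algebra.Properties.Group as GroupProperties
import Algebra.Properties.Ring as RingProperties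
import Algebra.Properties.Semiring.Sum as SumProperties
import Algebra.Solver.Ring.NaturalCoefficients.Default as Solver
open import Data.Fin.Base using (toℕ)
open import Data.Nat.Base as ℕ using (ℕ; zero; suc; _∸_; _<_; NonZero)
import Data.Nat.Properties as ℕ
open import Data.Product.Base using (Σ-syntax; _,_; proj₁; proj₂; map₂)
open import Data.Rational.Base as ℚ using (ℚ; 0ℚ; 1ℚ)
import Data.Rational.Properties as ℚ
open import Data.Unit.Base using (tt)
open import Level using (lift; _⊔_)
open import Relation.Binary.PropositionalEquality as ≡ using (_≡_; _≢_)
import Relation.Binary.Reasoning.Setoid as SetoidReasoning

import Defs

-- Division in a Heyting field.

module HeytingFieldProperties {c ℓ₁ ℓ₂} (K : HeytingField c ℓ₁ ℓ₂) where
  open HeytingField K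
  open HeytingProperties heytingCommutativeRing using (x-0≈x; invertibleʳ⇒#; #-congʳ)
  open Defs.ContinuedFractions K using (_/_[_])
  open SetoidReasoning setoid

  /-*-cancel : ∀ x {y} (y#0 : y # 0#) → (x / y [ y#0 ]) * y ≈ x
  /-*-cancel x {y} y#0 = begin
    x * y⁻¹ * y           ≈⟨ *-assoc x y⁻¹ y ⟩
    x * (y⁻¹ * y)         ≈⟨ *-congˡ (*-congˡ (x-0≈x y)) ⟨
    x * (y⁻¹ * (y - 0#))  ≈⟨ *-congˡ (proj₁ (proj₂ (#⇒invertible y#0))) ⟩
    x * 1#                ≈⟨ *-identityʳ x ⟩
    x                     ∎
    where y⁻¹ = proj₁ (#⇒invertible y#0)

  *-/-cancel : ∀ x {y} (y#0 : y # 0#) → (x * y) / y [ y#0 ] ≈ x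
  *-/-cancel x {y} y#0 = begin
    x * y * y⁻¹    ≈⟨ *-assoc x y y⁻¹ ⟩
    x * (y * y⁻¹)  ≈⟨ *-congˡ (*-comm y y⁻¹) ⟩
    x * (y⁻¹ * y)  ≈⟨ *-assoc x y⁻¹ y ⟨
    x * y⁻¹ * y    ≈⟨ /-*-cancel x y#0 ⟩
    x              ∎
    where y⁻¹ = proj₁ (#⇒invertible y#0)

  *-cancelʳ-#0 : ∀ {x y z} → z # 0# → x * z ≈ y * z → x ≈ y
  *-cancelʳ-#0 {x} {y} {z} z#0 xz≈yz = begin
    x                      ≈⟨ *-/-cancel x z#0 ⟨
    (x * z) / z [ z#0 ]    ≈⟨ *-congʳ xz≈yz ⟩
    (y * z) / z [ z#0 ]    ≈⟨ *-/-cancel y z#0 ⟩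
    y                      ∎

  -- `y` times an inverse of `x * y` is an inverse of `x`.
  x*y#0⇒x#0 : ∀ {x y} → x * y # 0# → x # 0#
  x*y#0⇒x#0 {x} {y} xy#0 = invertibleʳ⇒# (y * [xy]⁻¹ , (begin
    (x - 0#) * (y * [xy]⁻¹)  ≈⟨ *-congʳ (x-0≈x x) ⟩
    x * (y * [xy]⁻¹)         ≈⟨ *-assoc x y [xy]⁻¹ ⟨
    x * y * [xy]⁻¹           ≈⟨ *-congʳ (x-0≈x (x * y)) ⟨
    (x * y - 0#) * [xy]⁻¹    ≈⟨ proj₂ (proj₂ (#⇒invertible xy#0)) ⟩
    1#                       ∎))
    where [xy]⁻¹ = proj₁ (#⇒invertible xy#0)

  /-#0 : ∀ {x y} → x # 0# → (y#0 : y # 0#) → x / y [ y#0 ] # 0#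
  /-#0 {x} x#0 y#0 = x*y#0⇒x#0 (#-congʳ (sym (/-*-cancel x y#0)) x#0)

  x/1≈x : ∀ x (1#0 : 1# # 0#) → x / 1# [ 1#0 ] ≈ x
  x/1≈x x 1#0 = trans (sym (*-identityʳ _)) (/-*-cancel x 1#0)

  *-/-cancel-middle : ∀ x {y z} (y#0 : y # 0#) (z#0 : z # 0#) →
    (y / z [ z#0 ]) * (x / y [ y#0 ]) ≈ x / z [ z#0 ]
  *-/-cancel-middle x {y} {z} y#0 z#0 = *-cancelʳ-#0 z#0 (begin
    (y / z [ z#0 ]) * (x / y [ y#0 ]) * z    ≈⟨ *-congʳ (*-comm _ (x / y [ y#0 ])) ⟩
    (x / y [ y#0 ]) * (y / z [ z#0 ]) * z    ≈⟨ *-assoc (x / y [ y#0 ]) (y / z [ z#0 ]) z ⟩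
    (x / y [ y#0 ]) * ((y / z [ z#0 ]) * z)  ≈⟨ *-congˡ (/-*-cancel y z#0) ⟩
    (x / y [ y#0 ]) * y                      ≈⟨ /-*-cancel x y#0 ⟩
    x                                        ≈⟨ /-*-cancel x z#0 ⟨
    (x / z [ z#0 ]) * z                      ∎)

  -- Both sides equal `x / z`. For consecutive indices this is the relation between `θx`, `θy` and
  -- `y / x` on which the induction rests.
  *-/-exchange : ∀ x {y y′ z} (y#0 : y # 0#) (y′#0 : y′ # 0#) (z#0 : z # 0#) →
    (y / z [ z#0 ]) * (x / y [ y#0 ]) ≈ (x / y′ [ y′#0 ]) * (y′ / z [ z#0 ])
  *-/-exchange x y#0 y′#0 z#0 = trans (*-/-cancel-middle x y#0 z#0)
    (sym (trans (*-comm _ _) (*-/-cancel-middle x y′#0 z#0)))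

-- Alternating sums in a commutative ring.

module AlternatingSum {c ℓ} (R : CommutativeRing c ℓ) (q : ℕ → CommutativeRing.Carrier R) where
  open CommutativeRing R
  open RingProperties ring using (-1*x≈-x; //-rightDividesˡ)
  open RawMonoidDefinitions +-rawMonoid using (sum)
  open RawSemiringDefinitions (Semiring.rawSemiring semiring) using (_^_)
  open SumProperties semiring using (sum-cong-≋; *-distribˡ-sum)
  open SetoidReasoning setoid

  alternating : (k n : ℕ) → Carrier
  alternating k zero    = 0#
  alternating k (suc n) = q k - alternating (suc k) n

  alternating-suc : ∀ k n → alternating k (suc n) + alternating (suc k) n ≈ q k
  alternating-suc k n = //-rightDividesˡ (alternating (suc k) n) (q k)

  -- Pulling `- 1#` out of every term after the first leaves a sum of the same shape started at
  -- `suc k`. The separate `f` absorbs the shift of the summation index while `q` stays fixed.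
  sum≈alternating : ∀ k n {f : ℕ → Carrier} → (∀ i → f i ≈ q (i ℕ.+ k)) →
    sum {n} (λ i → (- 1#) ^ toℕ i * f (toℕ i)) ≈ alternating k n
  sum≈alternating k zero    f≈q = refl
  sum≈alternating k (suc n) {f} f≈q = +-cong (trans (*-identityˡ (f 0)) (f≈q 0)) (begin
    sum {n} (λ i → (- 1#) * (- 1#) ^ toℕ i * f (suc (toℕ i)))
      ≈⟨ sum-cong-≋ {n} (λ i → *-assoc (- 1#) ((- 1#) ^ toℕ i) (f (suc (toℕ i)))) ⟩
    sum {n} (λ i → (- 1#) * ((- 1#) ^ toℕ i * f (suc (toℕ i))))
      ≈⟨ *-distribˡ-sum {n} (- 1#) (λ i → (- 1#) ^ toℕ i * f (suc (toℕ i))) ⟨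
    (- 1#) * sum {n} (λ i → (- 1#) ^ toℕ i * f (suc (toℕ i)))
      ≈⟨ -1*x≈-x _ ⟩
    - sum {n} (λ i → (- 1#) ^ toℕ i * f (suc (toℕ i)))
      ≈⟨ -‿cong (sum≈alternating (suc k) n λ i →
           trans (f≈q (suc i)) (reflexive (≡.cong q (≡.sym (ℕ.+-suc i k))))) ⟩
    - alternating (suc k) n ∎)

-- Continued fractions of alternating sums.

module EulerContinuedFraction {c ℓ₁ ℓ₂} (K : HeytingField c ℓ₁ ℓ₂) where
  open HeytingField K
  open HeytingCommutativeRing heytingCommutativeRing using (commutativeRing)
  open CommutativeRing commutativeRing using (commutativeSemiring; +-group)
  open HeytingProperties heytingCommutativeRing using (x#0y#0→xy#0; #-congʳ)
  open GroupProperties +-group using (∙-cancelʳ)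
  open HeytingFieldProperties K
  open Defs.ContinuedFractions K
  open SetoidReasoning setoid
  open Solver commutativeSemiring using (solve; _:=_; _:+_; _:*_)

  -- r, s and q stand for θx, θy and y / x.
  module _ (a b r s q : ℕ → Carrier) where
    open AlternatingSum commutativeRing q

    module _
      (s#0 : ∀ k → s k # 0#)
      (alternating#0 : ∀ k n → alternating (suc k) (suc n) # 0#)
      (rq≈sq : ∀ k → r (suc k) * q (suc (suc k)) ≈ s (suc k) * q (suc k))
      (a≈sr : ∀ k → a (suc (suc k)) ≈ s (suc k) * r k)
      (b+s≈r : ∀ k → b (suc (suc k)) + s (suc k) ≈ r (suc k))
      where

      -- Definedness and value are proved together because the value of one tail shows that the next
      -- divisor is nonzero. In multiplied-out form the value formula also covers the empty tail,
      -- where both sides vanish.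
      record Tail (k m : ℕ) : Set (ℓ₁ ⊔ ℓ₂) where
        constructor tail
        field
          defined : Defined a b (suc (suc k)) m
          value≈  : value a b (suc (suc k)) m defined * alternating (suc k) (suc m)
                      ≈ r k * alternating (suc (suc k)) m

      -- The divisor `d` is fixed only up to `≈`, since `Defined` with one level uses `b k` itself
      -- rather than `b k + 0#`.
      module _ (k m : ℕ) {t : Carrier}
        (t≈ : t * alternating (suc (suc k)) (suc m) ≈ r (suc k) * alternating (suc (suc (suc k))) m)
        {d : Carrier} (d≈ : d ≈ b (suc (suc k)) + t) where

        private
          A₁ = alternating (suc k) (suc (suc m))
          A₂ = alternating (suc (suc k)) (suc m)
          A₃ = alternating (suc (suc (suc k))) m
          b₂ = b (suc (suc k))
          r₁ = r (suc k)
          s₁ = s (suc k)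

        -- Adding `s₁ * A₂` to both sides turns `b₂` into `r₁`. The sums `A₂ + A₃` and `A₁ + A₂`
        -- then collapse to consecutive terms of `q`, which `rq≈sq` matches.
        divisor≈ : d * A₂ ≈ s₁ * A₁
        divisor≈ = ∙-cancelʳ (s₁ * A₂) _ _ (begin
          d * A₂ + s₁ * A₂         ≈⟨ +-congʳ (*-congʳ d≈) ⟩
          (b₂ + t) * A₂ + s₁ * A₂
            ≈⟨ solve 4 (λ b t s A → (b :+ t) :* A :+ s :* A := (b :+ s) :* A :+ t :* A) refl b₂ t s₁ A₂ ⟩
          (b₂ + s₁) * A₂ + t * A₂  ≈⟨ +-cong (*-congʳ (b+s≈r k)) t≈ ⟩
          r₁ * A₂ + r₁ * A₃        ≈⟨ distribˡ r₁ A₂ A₃ ⟨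
          r₁ * (A₂ + A₃)           ≈⟨ *-congˡ (alternating-suc (suc (suc k)) m) ⟩
          r₁ * q (suc (suc k))     ≈⟨ rq≈sq k ⟩
          s₁ * q (suc k)           ≈⟨ *-congˡ (alternating-suc (suc k) (suc m)) ⟨
          s₁ * (A₁ + A₂)           ≈⟨ distribˡ s₁ A₁ A₂ ⟩
          s₁ * A₁ + s₁ * A₂        ∎)

        divisor#0 : d # 0#
        divisor#0 = x*y#0⇒x#0 (#-congʳ (sym divisor≈)
          (x#0y#0→xy#0 (s#0 (suc k)) (alternating#0 k (suc m))))

        -- The factor `s₁` lets `divisor≈` trade `s₁ * A₁` for `d * A₂`, and this `d` cancels the
        -- divisor of the quotient.
        quotient≈ : (a (suc (suc k)) / d [ divisor#0 ]) * A₁ ≈ r k * A₂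
        quotient≈ = *-cancelʳ-#0 (s#0 (suc k)) (begin
          v * A₁ * s₁               ≈⟨ *-assoc v A₁ s₁ ⟩
          v * (A₁ * s₁)             ≈⟨ *-congˡ (*-comm A₁ s₁) ⟩
          v * (s₁ * A₁)             ≈⟨ *-congˡ divisor≈ ⟨
          v * (d * A₂)              ≈⟨ *-assoc v d A₂ ⟨
          v * d * A₂                ≈⟨ *-congʳ (/-*-cancel (a (suc (suc k))) divisor#0) ⟩
          a (suc (suc k)) * A₂      ≈⟨ *-congʳ (a≈sr k) ⟩
          s₁ * r k * A₂
            ≈⟨ solve 3 (λ s r A → s :* r :* A := r :* A :* s) refl s₁ (r k) A₂ ⟩
          r k * A₂ * s₁             ∎)
          where v = a (suc (suc k)) / d [ divisor#0 ]

      tails : ∀ k m → Tail k m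
      tails k zero          = tail (lift tt) (trans (zeroˡ _) (sym (zeroʳ _)))
      tails k (suc zero)    = tail (divisor#0 k 0 t≈ d≈) (quotient≈ k 0 t≈ d≈)
        where
        t≈ = Tail.value≈ (tails (suc k) 0)
        d≈ = sym (+-identityʳ (b (suc (suc k))))
      tails k (suc (suc m)) with tails (suc k) (suc m)
      ... | tail d t≈ = tail (d , divisor#0 k (suc m) t≈ refl) (quotient≈ k (suc m) t≈ refl)

      -- The leading level is treated apart because `b 1` is `r 0` with no `s` subtracted.
      module _ (a₁#0 : a 1 # 0#) (rq≈a : r 0 * q 1 ≈ a 1) (b≈r : b 1 ≈ r 0) where

        module _ (m : ℕ) {t : Carrier} (t≈ : t * alternating 1 (suc m) ≈ r 0 * alternating 2 m)
          {d : Carrier} (d≈ : d ≈ b 1 + t) where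

          private
            A₁ = alternating 1 (suc m)
            A₂ = alternating 2 m

          -- Once `r 0` is factored out, `A₁ + A₂` collapses to the single term `q 1`.
          leading-divisor≈ : d * A₁ ≈ a 1
          leading-divisor≈ = begin
            d * A₁               ≈⟨ *-congʳ d≈ ⟩
            (b 1 + t) * A₁       ≈⟨ distribʳ A₁ (b 1) t ⟩
            b 1 * A₁ + t * A₁    ≈⟨ +-cong (*-congʳ b≈r) t≈ ⟩
            r 0 * A₁ + r 0 * A₂  ≈⟨ distribˡ (r 0) A₁ A₂ ⟨
            r 0 * (A₁ + A₂)      ≈⟨ *-congˡ (alternating-suc 1 m) ⟩
            r 0 * q 1            ≈⟨ rq≈a ⟩
            a 1                  ∎

          leading-divisor#0 : d # 0#
          leading-divisor#0 = x*y#0⇒x#0 (#-congʳ (sym leading-divisor≈) a₁#0)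

          leading-quotient≈ : A₁ ≈ a 1 / d [ leading-divisor#0 ]
          leading-quotient≈ = *-cancelʳ-#0 leading-divisor#0 (begin
            A₁ * d                               ≈⟨ *-comm A₁ d ⟩
            d * A₁                               ≈⟨ leading-divisor≈ ⟩
            a 1                                  ≈⟨ /-*-cancel (a 1) leading-divisor#0 ⟨
            (a 1 / d [ leading-divisor#0 ]) * d  ∎)

        alternating≈value : ∀ m → Σ[ d ∈ Defined a b 1 (suc m) ]
          alternating 1 (suc m) ≈ value a b 1 (suc m) d
        alternating≈value zero    = leading-divisor#0 0 t≈ d≈ , leading-quotient≈ 0 t≈ d≈
          where
          t≈ = Tail.value≈ (tails 0 0)
          d≈ = sym (+-identityʳ (b 1))
        alternating≈value (suc m) with tails 0 (suc m)
        ... | tail d t≈ = (d , leading-divisor#0 (suc m) t≈ refl) , leading-quotient≈ (suc m) t≈ refl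

open import Defs
open HeytingField ℚ⟨x,y⟩ using (Carrier; _-_; _#_; 0#; heytingCommutativeRing; refl; reflexive; sym; trans)
open HeytingCommutativeRing heytingCommutativeRing using (commutativeRing)
open CommutativeRing commutativeRing using (+-group)
open GroupProperties +-group using (//-rightDividesˡ)
open HeytingFieldProperties ℚ⟨x,y⟩ using (/-#0; x/1≈x; *-/-cancel-middle; *-/-exchange)
open Polynomials Indeterminate _≟ⁱ_
  using (discreteDomain; eval; eval-cong; _[_↦_]; update-here; update-other)
open FractionField discreteDomain using (num; den; uncross)

-- Nonvanishing of the alternating sums by evaluation.

ratio : ℕ → Carrier
ratio k = y k / x k [ x#0 k ]

open AlternatingSum commutativeRing ratio

xs-1-ys-0 : Indeterminate → ℚ
xs-1-ys-0 (X _) = 1ℚ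
xs-1-ys-0 (Y _) = 0ℚ

-- `Y k` stands for the indeterminate with index `suc k`, the numerator of the first term of
-- `alternating (suc k)`.
point : ℕ → Indeterminate → ℚ
point k = xs-1-ys-0 [ Y k ↦ 1ℚ ]

-- Fixing the value of the denominator at 1 avoids division in ℚ.
record _⟦_⟧≡_ (p : Carrier) (u : Indeterminate → ℚ) (c : ℚ) : Set where
  constructor evaluates
  field
    eval-num : eval u (num p) ≡ c
    eval-den : eval u (den p) ≡ 1ℚ

minus-eval : ∀ {u c d} p q → p ⟦ u ⟧≡ c → q ⟦ u ⟧≡ d → (p - q) ⟦ u ⟧≡ (c ℚ.- d)
minus-eval {u} {c} {d} p q (evaluates np dp) (evaluates nq dq) = evaluates
  (≡.cong₂ ℚ._+_
    (≡.trans (≡.cong₂ ℚ._*_ np dq) (ℚ.*-identityʳ c))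
    (≡.trans (≡.cong₂ (λ n e → ℚ.- n ℚ.* e) nq dp) (ℚ.*-identityʳ (ℚ.- d))))
  (≡.cong₂ ℚ._*_ dp dq)

ratio-eval : ∀ k i {c} → point k (Y i) ≡ c → ratio (suc i) ⟦ point k ⟧≡ c
-- The denominator is built from constants and `X i`, which `point k` sends to 1, so its value
-- computes.
ratio-eval k i Yi≡c = evaluates (≡.trans (ℚ.*-identityʳ _) Yi≡c) ≡.refl

-- The numerators are `Y i` and later ones, all different from `Y k`, so every term vanishes at
-- `point k`.
alternating-eval-0 : ∀ k i n → k < i → alternating (suc i) n ⟦ point k ⟧≡ 0ℚ
alternating-eval-0 k i zero    k<i = evaluates ≡.refl ≡.refl
alternating-eval-0 k i (suc n) k<i = minus-eval (ratio (suc i)) (alternating (suc (suc i)) n)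
  (ratio-eval k i (update-other xs-1-ys-0 {Y k} {Y i} 1ℚ λ { ≡.refl → ℕ.<-irrefl ≡.refl k<i }))
  (alternating-eval-0 k (suc i) n (ℕ.m<n⇒m<1+n k<i))

alternating-eval-1 : ∀ k n → alternating (suc k) (suc n) ⟦ point k ⟧≡ 1ℚ
alternating-eval-1 k n = minus-eval (ratio (suc k)) (alternating (suc (suc k)) n)
  (ratio-eval k k (update-here xs-1-ys-0 (Y k) 1ℚ))
  (alternating-eval-0 k (suc k) n (ℕ.n<1+n k))

-- After cross multiplication `p ≈ 0#` is a polynomial identity, which evaluation preserves.
evaluates⇒#0 : ∀ {p u c} → p ⟦ u ⟧≡ c → c ≢ 0ℚ → p # 0#
evaluates⇒#0 {p} {u} {c} (evaluates np _) c≢0 p≈0 = c≢0 (begin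
  c                       ≡⟨ np ⟨
  eval u (num p)          ≡⟨ ℚ.*-identityʳ _ ⟨
  eval u (num p) ℚ.* 1ℚ   ≡⟨ eval-cong u (uncross p≈0) ⟩
  0ℚ ℚ.* eval u (den p)   ≡⟨ ℚ.*-zeroˡ (eval u (den p)) ⟩
  0ℚ                      ∎)
  where open ≡.≡-Reasoning

alternating#0 : ∀ k n → alternating (suc k) (suc n) # 0#
alternating#0 k n = evaluates⇒#0 {alternating (suc k) (suc n)} (alternating-eval-1 k n) λ ()

-- The identity in the field of rational functions.

theorem1 : ∀ (n : ℕ) .{{_ : NonZero n}} →
    Σ[ d ∈ Defined a b 1 n ]
    sum {n} (λ i → let k = suc (toℕ i) in (- 1#) ^ (k ∸ 1) * (y k / x k [ x#0 k ]))
    ≈ value a b 1 n d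
theorem1 (suc m) = map₂
  (trans (sum≈alternating 1 (suc m) λ i → reflexive (≡.cong ratio (ℕ.+-comm 1 i))))
  (EulerContinuedFraction.alternating≈value ℚ⟨x,y⟩ a b θx θy ratio
    (λ k → /-#0 (y#0 (suc k)) (y#0 k))
    alternating#0
    (λ k → *-/-exchange (y (suc (suc k))) (x#0 (suc (suc k))) (y#0 (suc k)) (x#0 (suc k)))
    (λ k → refl {a (suc (suc k))})
    (λ k → //-rightDividesˡ (θy (suc k)) (θx (suc k)))
    (y#0 1)
    -- As `x 0` is `1#`, `θx 0` equals `x 1`, which ties the exceptional `a 1` and `b 1` to `θx 0`.
    (trans {θx 0 * ratio 1} {y 1 / x 0 [ x#0 0 ]} {y 1}
      (*-/-cancel-middle (y 1) (x#0 1) (x#0 0)) (x/1≈x (y 1) 1#0))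
    (sym {θx 0} {x 1} (x/1≈x (x 1) 1#0))
    m)
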